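{- $\mathrm{Bounded\ MITL}[\mathsf F_b,\mathsf P_b]\subsetneq\mathrm{MITL}[\mathsf F_\infty,\mathsf P_\infty]$ in expressive power: every timed language definable by a $\mathrm{Bounded\ MITL}[\mathsf F_b,\mathsf P_b]$ formula is definable by an $\mathrm{MITL}[\mathsf F_\infty,\mathsf P_\infty]$ formula, and there is a timed language definable in $\mathrm{MITL}[\mathsf F_\infty,\mathsf P_\infty]$ that is not definable in $\mathrm{Bounded\ MITL}[\mathsf F_b,\mathsf P_b]$.
   Context: Timed words: let $\Sigma$ be a finite alphabet. A timed word over $\Sigma$ is a finite nonempty sequence $\rho=(\sigma_1,\tau_1)\cdots(\sigma_n,\tau_n)$ with $\sigma_i\in\Sigma$ and real time stamps $0=\tau_1<\tau_2<\cdots<\tau_n$ (strictly monotonic time). $T\Sigma^*$ is the set of timed words over $\Sigma$. Logics: formulas are $\phi::= a\mid \phi\lor\phi\mid\neg\phi\mid \mathsf F_I\phi\mid \mathsf P_I\phi$ with $a\in\Sigma$. Semantics: $\rho,i\models a$ iff $\sigma_i=a$; Boolean connectives as usual; $\rho,i\models\mathsf F_I\phi$ iff there is $j>i$ with $\tau_j-\tau_i\in I$ and $\rho,j\models\phi$; $\rho,i\models\mathsf P_I\phi$ iff there is $j<i$ with $\tau_i-\tau_j\in I$ and $\rho,j\models\phi$. The language defined by $\phi$ is $\mathcal L(\phi)=\{\rho\in T\Sigma^*\mid\rho,1\models\phi\}$. - $\mathrm{Bounded\ MITL}[\mathsf F_b,\mathsf P_b]$: every $I$ is a bounded non-singular interval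 $\langle l,u\rangle$ (open or closed at each end) with integer endpoints $0\le l<u<\infty$. - $\mathrm{MITL}[\mathsf F_\infty,\mathsf P_\infty]$: every $I$ is of the form $[l,\infty)$ or $(l,\infty)$ with $l$ a non-negative integer. Timed languages over all finite alphabets are considered. -}

module Defs where

open import Data.Empty using (⊥)
open import Data.Fin.Base using (Fin; zero; suc; inject₁)
import Data.Fin.Base as Fin
open import Data.Integer.Base using (+_)
open import Data.Nat.Base using (ℕ; suc)
import Data.Nat.Base as ℕ
import Data.Nat.Properties as ℕ
open import Data.Product.Base using (∃; _×_; _,_)
open import Data.Rational.Base using (ℚ; 0ℚ; ½; _+_; _-_; _*_; _<_; _/_; ∣_∣)
import Data.Rational.Properties as ℚ
open import Data.Rational.Solver using (module +-*-Solver)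
open import Data.Sum.Base using (_⊎_)
open import Data.Unit.Base using (⊤)
open import Function.Bundles using (_↔_)
open import Level using (0ℓ)
open import Relation.Binary.PropositionalEquality using (_≡_; refl; sym; cong; subst)
open import Relation.Nullary.Negation using (¬_)
open import Relation.Unary using (Pred; _≐_)

-- Real numbers as Cauchy sequences of rationals.

IsCauchy : (ℕ → ℚ) → Set
IsCauchy s = ∀ ε → 0ℚ < ε →
  ∃ λ N → ∀ m n → N ℕ.≤ m → N ℕ.≤ n → ∣ s m - s n ∣ < ε

record ℝ : Set where
  constructor mkℝ
  field
    seq    : ℕ → ℚ
    cauchy : IsCauchy seq

open ℝ public

infix 4 _<ᵣ_ _≤ᵣ_ _≃ᵣ_
infixl 6 _-ᵣ_

-- The gap ε must be uniform: a termwise strict inequality would only give ≤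
-- in the limit.
_<ᵣ_ : ℝ → ℝ → Set
x <ᵣ y = ∃ λ ε → 0ℚ < ε × ∃ λ N → ∀ n → N ℕ.≤ n → seq x n + ε < seq y n

_≤ᵣ_ : ℝ → ℝ → Set
x ≤ᵣ y = ¬ (y <ᵣ x)

_≃ᵣ_ : ℝ → ℝ → Set
x ≃ᵣ y = x ≤ᵣ y × y ≤ᵣ x

fromℕᵣ : ℕ → ℝ
fromℕᵣ k = mkℝ (λ _ → q) λ ε 0<ε → 0 , λ _ _ _ _ →
  subst (_< ε) (sym (cong ∣_∣ (ℚ.+-inverseʳ q))) 0<ε
  where
  q : ℚ
  q = + k / 1

_-ᵣ_ : ℝ → ℝ → ℝ
x -ᵣ y = mkℝ (λ n → seq x n - seq y n) isCauchy
  where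
  regroup : ∀ a b c d → (a - b) - (c - d) ≡ (a - c) - (b - d)
  regroup = solve 4 (λ a b c d →
      ((a :- b) :- (c :- d)) := ((a :- c) :- (b :- d))) refl
    where open +-*-Solver

  halves : ∀ ε → ½ * ε + ½ * ε ≡ ε
  halves = solve 1 (λ ε → (con ½ :* ε :+ con ½ :* ε) := ε) refl
    where open +-*-Solver

  isCauchy : IsCauchy (λ n → seq x n - seq y n)
  isCauchy ε 0<ε
    with 0<½ε ← subst (_< ½ * ε) (ℚ.*-zeroʳ ½) (ℚ.*-monoʳ-<-pos ½ 0<ε)
    with (M , p) ← cauchy x (½ * ε) 0<½ε | (N , q) ← cauchy y (½ * ε) 0<½ε
    = M ℕ.⊔ N , λ m n m≥ n≥ → let open ℚ.≤-Reasoning in begin-strict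
        ∣ (seq x m - seq y m) - (seq x n - seq y n) ∣
          ≡⟨ cong ∣_∣ (regroup (seq x m) (seq y m) (seq x n) (seq y n)) ⟩
        ∣ (seq x m - seq x n) - (seq y m - seq y n) ∣
          ≤⟨ ℚ.∣p-q∣≤∣p∣+∣q∣ (seq x m - seq x n) (seq y m - seq y n) ⟩
        ∣ seq x m - seq x n ∣ + ∣ seq y m - seq y n ∣
          <⟨ ℚ.+-mono-< (p m n (ℕ.m⊔n≤o⇒m≤o M N m≥) (ℕ.m⊔n≤o⇒m≤o M N n≥))
                        (q m n (ℕ.m⊔n≤o⇒n≤o M N m≥) (ℕ.m⊔n≤o⇒n≤o M N n≥)) ⟩
        ½ * ε + ½ * ε
          ≡⟨ halves ε ⟩
        ε ∎

Finite : Set → Set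
Finite A = ∃ λ n → A ↔ Fin n

-- Positions are numbered from zero, so `zero` is the paper's position 1.
record TimedWord (A : Set) : Set where
  field
    pred-length : ℕ

  Position : Set
  Position = Fin (suc pred-length)

  field
    letter     : Position → A
    time       : Position → ℝ
    starts-at-0 : time zero ≃ᵣ fromℕᵣ 0
    increasing : ∀ (i : Fin pred-length) → time (inject₁ i) <ᵣ time (suc i)

open TimedWord public

data Bracket : Set where
  closed open′ : Bracket

_≲[_]_ : ℝ → Bracket → ℝ → Set
x ≲[ closed ] y = x ≤ᵣ y
x ≲[ open′  ] y = x <ᵣ y

data Interval : Set where
  ⟨_,_,_,_⟩ : Bracket → ℕ → ℕ → Bracket → Interval
  ⟨_,_,∞⟩   : Bracket → ℕ → Interval

infix 4 _∈ᵢ_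

_∈ᵢ_ : ℝ → Interval → Set
x ∈ᵢ ⟨ b , l , u , b′ ⟩ = fromℕᵣ l ≲[ b ] x × x ≲[ b′ ] fromℕᵣ u
x ∈ᵢ ⟨ b , l ,∞⟩        = fromℕᵣ l ≲[ b ] x

-- A fragment is given by the intervals its modalities may carry.
Fragment : Set₁
Fragment = Interval → Set

data Formula (K : Fragment) (A : Set) : Set where
  atom : A → Formula K A
  _∨ᶠ_ : Formula K A → Formula K A → Formula K A
  ¬ᶠ_  : Formula K A → Formula K A
  𝖥 𝖯  : (I : Interval) → K I → Formula K A → Formula K A

infix 4 _at_⊨_

_at_⊨_ : ∀ {K A} (ρ : TimedWord A) → Position ρ → Formula K A → Set
ρ at i ⊨ atom a   = letter ρ i ≡ a
ρ at i ⊨ φ ∨ᶠ ψ   = ρ at i ⊨ φ ⊎ ρ at i ⊨ ψ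
ρ at i ⊨ ¬ᶠ φ     = ¬ (ρ at i ⊨ φ)
ρ at i ⊨ 𝖥 I _ φ  = ∃ λ j → i Fin.< j × (time ρ j -ᵣ time ρ i) ∈ᵢ I × ρ at j ⊨ φ
ρ at i ⊨ 𝖯 I _ φ  = ∃ λ j → j Fin.< i × (time ρ i -ᵣ time ρ j) ∈ᵢ I × ρ at j ⊨ φ

Language : Set → Set₁
Language A = Pred (TimedWord A) 0ℓ

𝓛 : ∀ {K A} → Formula K A → Language A
𝓛 φ ρ = ρ at zero ⊨ φ

Definable : Fragment → {A : Set} → Language A → Set
Definable K {A} L = ∃ λ (φ : Formula K A) → L ≐ 𝓛 φ

BoundedMITL[Fb,Pb] : Fragment
BoundedMITL[Fb,Pb] ⟨ _ , l , u , _ ⟩ = l ℕ.< u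
BoundedMITL[Fb,Pb] ⟨ _ , _ ,∞⟩       = ⊥

MITL[F∞,P∞] : Fragment
MITL[F∞,P∞] ⟨ _ , _ , _ , _ ⟩ = ⊥
MITL[F∞,P∞] ⟨ _ , _ ,∞⟩       = ⊤

infix 4 _⊆ₑ_ _⊊ₑ_

-- Comparison of expressive power.
_⊆ₑ_ : Fragment → Fragment → Set₁
K ⊆ₑ K′ = ∀ {A : Set} → Finite A → (L : Language A) → Definable K L → Definable K′ L

_⊊ₑ_ : Fragment → Fragment → Set₁
K ⊊ₑ K′ = K ⊆ₑ K′ ×
  ∃ λ (A : Set) → Finite A × ∃ λ (L : Language A) → Definable K′ L × ¬ Definable K L

module Submission where

-- A word starts at time 0, so [k,∞)-modalities into the past express the integer
-- part of the absolute time of a position, and a bounded formula evaluated at the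
-- start only visits boundedly many unit intervals [m, m+1). Translating relative
-- to the unit of the current position, a bounded modality becomes a disjunction
-- over the unit of its target; there at most one of its two bounds is a real
-- constraint, because the interval is non-singular. For strictness, "there is a
-- later position" is invisible to a bounded formula once that position is far away.

open import Defs
open import Axiom.ExcludedMiddle using (ExcludedMiddle)
open import Level using (0ℓ)
open import Data.Empty using (⊥-elim)
open import Data.Fin.Base as Fin using (Fin; zero; suc; inject₁)
import Data.Fin.Induction as Fin
import Data.Fin.Properties as Fin
open import Data.Integer.Base as ℤ using (+_)
import Data.Integer.Properties as ℤ
open import Data.Nat.Base as ℕ using (ℕ; zero; suc)
import Data.Nat.Properties as ℕ
open import Data.Product.Base using (∃; _×_; _,_; proj₁; proj₂)
open import Data.Product.Function.NonDependent.Propositional using (_×-⇔_)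
open import Data.Rational.Base as ℚ
  using (ℚ; 0ℚ; ½; _+_; _-_; -_; _*_; _≤_; _<_; ∣_∣; toℚᵘ; fromℚᵘ)
import Data.Rational.Properties as ℚ
open import Data.Rational.Solver using (module +-*-Solver)
open import Data.Rational.Unnormalised.Base as ℚᵘ using (mkℚᵘ)
import Data.Rational.Unnormalised.Properties as ℚᵘ
open import Data.Sum.Base using (_⊎_; inj₁; inj₂; [_,_])
open import Data.Sum.Function.Propositional using (_⊎-⇔_)
open import Data.Unit.Base using (⊤; tt)
open import Function.Base using (id; _∘_)
open import Function.Bundles using (_⇔_; mk⇔; module Equivalence)
open import Function.Construct.Composition using (_⇔-∘_)
open import Function.Construct.Identity using (⇔-id)
open import Function.Construct.Symmetry using (↔-sym)
open import Function.Related.TypeIsomorphisms using (¬-cong-⇔)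
open import Induction.WellFounded using (WellFounded; Acc; acc)
open import Relation.Binary.Definitions using (tri<; tri≈; tri>)
open import Relation.Binary.PropositionalEquality
  using (_≡_; refl; sym; trans; cong; cong₂; subst)
open import Relation.Nullary using (¬_; Dec; yes; no; contradiction)
open import Relation.Nullary.Decidable using (decidable-stable)
open import Relation.Unary using (Pred)

open +-*-Solver using (solve; con; _:+_; _:-_; _:=_)
open Equivalence using (to; from)

private variable
  A : Set
  K : Fragment
  n p q : ℕ

-- Order on the reals

fromℚᵘ-homo-+ : ∀ s t → fromℚᵘ (s ℚᵘ.+ t) ≡ fromℚᵘ s + fromℚᵘ t
fromℚᵘ-homo-+ s t = ℚ.toℚᵘ-injective (begin
  toℚᵘ (fromℚᵘ (s ℚᵘ.+ t))              ≈⟨ ℚ.toℚᵘ-fromℚᵘ (s ℚᵘ.+ t) ⟩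
  s ℚᵘ.+ t                              ≈⟨ ℚᵘ.+-cong (ℚ.toℚᵘ-fromℚᵘ s) (ℚ.toℚᵘ-fromℚᵘ t) ⟨
  toℚᵘ (fromℚᵘ s) ℚᵘ.+ toℚᵘ (fromℚᵘ t)  ≈⟨ ℚ.toℚᵘ-homo-+ (fromℚᵘ s) (fromℚᵘ t) ⟨
  toℚᵘ (fromℚᵘ s + fromℚᵘ t)            ∎)
  where open ℚᵘ.≃-Reasoning

fromℚᵘ-mono-≤ : ∀ {s t} → s ℚᵘ.≤ t → fromℚᵘ s ≤ fromℚᵘ t
fromℚᵘ-mono-≤ {s} {t} s≤t = ℚ.toℚᵘ-cancel-≤ (begin
  toℚᵘ (fromℚᵘ s)  ≃⟨ ℚ.toℚᵘ-fromℚᵘ s ⟩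
  s                ≤⟨ s≤t ⟩
  t                ≃⟨ ℚ.toℚᵘ-fromℚᵘ t ⟨
  toℚᵘ (fromℚᵘ t)  ∎)
  where open ℚᵘ.≤-Reasoning

ι : ℕ → ℚ
ι k = + k ℚ./ 1

-- By computation `ι k` is `fromℚᵘ` of an unnormalised fraction, and addition of those involves no
-- gcd.
ι-homo-+ : ∀ m n → ι (m ℕ.+ n) ≡ ι m + ι n
ι-homo-+ m n = trans (cong fromℚᵘ (sym sum)) (fromℚᵘ-homo-+ (mkℚᵘ (+ m) 0) (mkℚᵘ (+ n) 0))
  where
  sum : mkℚᵘ (+ m) 0 ℚᵘ.+ mkℚᵘ (+ n) 0 ≡ mkℚᵘ (+ (m ℕ.+ n)) 0
  sum = cong (λ k → mkℚᵘ k 0) (cong₂ ℤ._+_ (ℤ.*-identityʳ (+ m)) (ℤ.*-identityʳ (+ n)))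

ι-mono-≤ : p ℕ.≤ q → ι p ≤ ι q
ι-mono-≤ {p} {q} p≤q = fromℚᵘ-mono-≤ {mkℚᵘ (+ p) 0} {mkℚᵘ (+ q) 0} (ℚᵘ.*≤* (ℤ.*-monoʳ-≤-nonNeg (+ 1) (ℤ.+≤+ p≤q)))

ι-sum-≤ : ∀ p q r → p ℕ.≤ q ℕ.+ r → ι p ≤ ι q + ι r
ι-sum-≤ p q r p≤q+r = ℚ.≤-trans (ι-mono-≤ p≤q+r) (ℚ.≤-reflexive (ι-homo-+ q r))

ι-sum-≥ : ∀ p q r → q ℕ.+ r ℕ.≤ p → ι q + ι r ≤ ι p
ι-sum-≥ p q r q+r≤p = ℚ.≤-trans (ℚ.≤-reflexive (sym (ι-homo-+ q r))) (ι-mono-≤ q+r≤p)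

∣p∣<q⇒p<q : ∀ {s t} → ∣ s ∣ < t → s < t
∣p∣<q⇒p<q {s} ∣s∣<t with 0ℚ ℚ.≤? s
... | yes 0≤s = subst (_< _) (ℚ.0≤p⇒∣p∣≡p 0≤s) ∣s∣<t
... | no  0≰s = ℚ.<-trans (ℚ.<-≤-trans (ℚ.≰⇒> 0≰s) (ℚ.0≤∣p∣ s)) ∣s∣<t

halve : ∀ {ε} → 0ℚ < ε → ∃ λ η → 0ℚ < η × η + η ≡ ε
halve {ε} 0<ε = ½ * ε , subst (_< ½ * ε) (ℚ.*-zeroʳ ½) (ℚ.*-monoʳ-<-pos ½ 0<ε) ,
  trans (sym (ℚ.*-distribʳ-+ ε ½ ½)) (ℚ.*-identityˡ ε)

p<p+q : ∀ {s ε} → 0ℚ < ε → s < s + ε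
p<p+q {s} {ε} 0<ε = subst (_< s + ε) (ℚ.+-identityʳ s) (ℚ.+-monoʳ-< s 0<ε)

-- With `ε = 4η`, compare one late term of `x -ᵣ y` with `2η`, a decidable question about rationals.
-- If it is smaller, all later terms stay below `3η`; otherwise they all exceed `η`, a uniform gap
-- that refutes `x ≤ᵣ y`.
≤ᵣ⇒eventually : ∀ x y → x ≤ᵣ y → ∀ ε → 0ℚ < ε →
  ∃ λ N → ∀ n → N ℕ.≤ n → seq x n < seq y n + ε
≤ᵣ⇒eventually x y x≤y ε 0<ε
  with (ζ , 0<ζ , refl) ← halve 0<ε
  with (η , 0<η , refl) ← halve 0<ζ
  = result
  where
  δ = x -ᵣ y
  N = proj₁ (cauchy δ η 0<η)

  close : ∀ m n → N ℕ.≤ m → N ℕ.≤ n → seq δ m - seq δ n < η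
  close m n m≥ n≥ = ∣p∣<q⇒p<q (proj₂ (cauchy δ η 0<η) m n m≥ n≥)

  result : ∃ λ N → ∀ n → N ℕ.≤ n → seq x n < seq y n + ((η + η) + (η + η))
  result with seq δ N ℚ.<? η + η
  ... | yes δ<2η = N , λ n n≥ → let open ℚ.≤-Reasoning in begin-strict
    seq x n
      ≡⟨ solve 3 (λ u v w → u := v :+ (w :+ ((u :- v) :- w))) refl (seq x n) (seq y n) (seq δ N) ⟩
    seq y n + (seq δ N + (seq δ n - seq δ N))
      <⟨ ℚ.+-monoʳ-< (seq y n) (ℚ.+-mono-< δ<2η (close n N n≥ ℕ.≤-refl)) ⟩
    seq y n + ((η + η) + η)
      <⟨ ℚ.+-monoʳ-< (seq y n) (ℚ.+-monoʳ-< (η + η) (p<p+q 0<η)) ⟩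
    seq y n + ((η + η) + (η + η)) ∎
  ... | no  δ≮2η = contradiction (η , 0<η , N , gap) x≤y
    where
    gap : ∀ n → N ℕ.≤ n → seq y n + η < seq x n
    gap n n≥ = begin-strict
      seq y n + η
        ≡⟨ solve 2 (λ v e → v :+ e := (v :+ (e :+ e)) :- e) refl (seq y n) η ⟩
      (seq y n + (η + η)) - η
        ≤⟨ ℚ.+-monoˡ-≤ (- η) (ℚ.+-monoʳ-≤ (seq y n) (ℚ.≮⇒≥ δ≮2η)) ⟩
      (seq y n + seq δ N) - η
        <⟨ ℚ.+-monoʳ-< (seq y n + seq δ N) (ℚ.neg-antimono-< (close N n ℕ.≤-refl n≥)) ⟩
      (seq y n + seq δ N) - (seq δ N - seq δ n)
        ≡⟨ solve 3 (λ u v w → (v :+ w) :- (w :- (u :- v)) := u) refl (seq x n) (seq y n) (seq δ N) ⟩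
      seq x n ∎
      where open ℚ.≤-Reasoning

-- Every fact about the order of ℝ used here is an instance of this one linear
-- combination of a strict and a weak inequality.
<ᵣ-combine : ∀ a b c d x y → a <ᵣ b → c ≤ᵣ d →
  (∀ n → (seq b n - seq a n) + (seq d n - seq c n) ≤ seq y n - seq x n) → x <ᵣ y
<ᵣ-combine a b c d x y (ε , 0<ε , M , a<b) c≤d le
  with (η , 0<η , refl) ← halve 0<ε
  with (N , c<d) ← ≤ᵣ⇒eventually c d c≤d η 0<η
  = η , 0<η , M ℕ.⊔ N , λ n n≥ →
    let A = seq a n; B = seq b n; C = seq c n; D = seq d n; X = seq x n; Y = seq y n
        open ℚ.≤-Reasoning
    in begin-strict
    X + η
      ≡⟨ solve 4 (λ u v w e → u :+ e := ((v :+ (e :+ e)) :+ w) :+ (u :- v :- w :- e)) refl X A C η ⟩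
    ((A + (η + η)) + C) + (X - A - C - η)
      <⟨ ℚ.+-monoˡ-< (X - A - C - η)
           (ℚ.+-mono-< (a<b n (ℕ.m⊔n≤o⇒m≤o M N n≥)) (c<d n (ℕ.m⊔n≤o⇒n≤o M N n≥))) ⟩
    (B + (D + η)) + (X - A - C - η)
      ≡⟨ solve 6 (λ u v v′ w w′ e → (v′ :+ (w′ :+ e)) :+ (u :- v :- w :- e) := u :+ ((v′ :- v) :+ (w′ :- w)))
           refl X A B C D η ⟩
    X + ((B - A) + (D - C))
      ≤⟨ ℚ.+-monoʳ-≤ X (le n) ⟩
    X + (Y - X)
      ≡⟨ solve 2 (λ u v → u :+ (v :- u) := v) refl X Y ⟩
    Y ∎

<ᵣ-irrefl : ∀ x → ¬ (x <ᵣ x)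
<ᵣ-irrefl x (ε , 0<ε , N , x<x) =
  ℚ.<-irrefl refl (ℚ.<-trans (p<p+q 0<ε) (x<x N ℕ.≤-refl))

≤ᵣ-refl : ∀ x → x ≤ᵣ x
≤ᵣ-refl = <ᵣ-irrefl

<-≤ᵣ-trans : ∀ a b c → a <ᵣ b → b ≤ᵣ c → a <ᵣ c
<-≤ᵣ-trans a b c a<b b≤c = <ᵣ-combine a b b c a c a<b b≤c λ n → ℚ.≤-reflexive
  (solve 3 (λ u v w → (v :- u) :+ (w :- v) := w :- u) refl (seq a n) (seq b n) (seq c n))

≤-<ᵣ-trans : ∀ a b c → a ≤ᵣ b → b <ᵣ c → a <ᵣ c
≤-<ᵣ-trans a b c a≤b b<c = <ᵣ-combine b c a b a c b<c a≤b λ n → ℚ.≤-reflexive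
  (solve 3 (λ u v w → (w :- v) :+ (v :- u) := w :- u) refl (seq a n) (seq b n) (seq c n))

≤ᵣ-trans : ∀ a b c → a ≤ᵣ b → b ≤ᵣ c → a ≤ᵣ c
≤ᵣ-trans a b c a≤b b≤c c<a = b≤c (<-≤ᵣ-trans c a b c<a a≤b)

<ᵣ⇒≤ᵣ : ∀ a b → a <ᵣ b → a ≤ᵣ b
<ᵣ⇒≤ᵣ a b (ε , 0<ε , M , a<b) (η , 0<η , N , b<a) = ℚ.<-irrefl refl
  (ℚ.<-trans (ℚ.<-trans (p<p+q 0<ε) (a<b (M ℕ.⊔ N) (ℕ.m≤m⊔n M N)))
             (ℚ.<-trans (p<p+q 0<η) (b<a (M ℕ.⊔ N) (ℕ.m≤n⊔m M N))))

-ᵣ-monoˡ-≤ : ∀ x y z → x ≤ᵣ y → x -ᵣ z ≤ᵣ y -ᵣ z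
-ᵣ-monoˡ-≤ x y z x≤y y-z<x-z = <ᵣ-irrefl z
  (<ᵣ-combine (y -ᵣ z) (x -ᵣ z) x y z z y-z<x-z x≤y λ n → ℚ.≤-reflexive
    (solve 3 (λ u v w → ((u :- w) :- (v :- w)) :+ (v :- u) := w :- w) refl
      (seq x n) (seq y n) (seq z n)))

-ᵣ-monoʳ-≤ : ∀ x y z → x ≤ᵣ y → z -ᵣ y ≤ᵣ z -ᵣ x
-ᵣ-monoʳ-≤ x y z x≤y z-x<z-y = <ᵣ-irrefl z
  (<ᵣ-combine (z -ᵣ x) (z -ᵣ y) x y z z z-x<z-y x≤y λ n → ℚ.≤-reflexive
    (solve 3 (λ u v w → ((w :- v) :- (w :- u)) :+ (v :- u) := w :- w) refl
      (seq x n) (seq y n) (seq z n)))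

x≤y⇒0≤y-x : ∀ x y → x ≤ᵣ y → fromℕᵣ 0 ≤ᵣ y -ᵣ x
x≤y⇒0≤y-x x y x≤y y-x<0 = <ᵣ-irrefl x
  (<ᵣ-combine (y -ᵣ x) (fromℕᵣ 0) x y x x y-x<0 x≤y λ n → ℚ.≤-reflexive
    (solve 2 (λ u v → (con 0ℚ :- (v :- u)) :+ (v :- u) := u :- u) refl (seq x n) (seq y n)))

x≤y-t∧0≤t⇒x≤y : ∀ x y t → x ≤ᵣ y -ᵣ t → fromℕᵣ 0 ≤ᵣ t → x ≤ᵣ y
x≤y-t∧0≤t⇒x≤y x y t x≤y-t 0≤t y<x = x≤y-t
  (<ᵣ-combine y x (fromℕᵣ 0) t (y -ᵣ t) x y<x 0≤t λ n → ℚ.≤-reflexive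
    (solve 3 (λ u v w → (u :- v) :+ (w :- con 0ℚ) := u :- (v :- w)) refl
      (seq x n) (seq y n) (seq t n)))

x≤y∧t≤0⇒x≤y-t : ∀ x y t → x ≤ᵣ y → t ≤ᵣ fromℕᵣ 0 → x ≤ᵣ y -ᵣ t
x≤y∧t≤0⇒x≤y-t x y t x≤y t≤0 y-t<x = x≤y
  (<ᵣ-combine (y -ᵣ t) x t (fromℕᵣ 0) y x y-t<x t≤0 λ n → ℚ.≤-reflexive
    (solve 3 (λ u v w → (u :- (v :- w)) :+ (con 0ℚ :- w) := u :- v) refl
      (seq x n) (seq y n) (seq t n)))

fromℕᵣ-mono-≤ : p ℕ.≤ q → fromℕᵣ p ≤ᵣ fromℕᵣ q
fromℕᵣ-mono-≤ {p} {q} p≤q (ε , 0<ε , N , q<p) = ℚ.<-irrefl refl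
  (ℚ.<-≤-trans (ℚ.<-trans (p<p+q 0<ε) (q<p N ℕ.≤-refl)) (ι-mono-≤ p≤q))

fromℕᵣ-mono-< : p ℕ.< q → fromℕᵣ p <ᵣ fromℕᵣ q
-- The gap must lie strictly below `q - p`, which can be as small as 1.
fromℕᵣ-mono-< {p} {q} p<q = ½ , 0<½ , 0 , λ _ _ → begin-strict
  ι p + ½      <⟨ ℚ.+-monoʳ-< (ι p) ½<1 ⟩
  ι p + ι 1    ≡⟨ ι-homo-+ p 1 ⟨
  ι (p ℕ.+ 1)  ≡⟨ cong ι (ℕ.+-comm p 1) ⟩
  ι (suc p)    ≤⟨ ι-mono-≤ p<q ⟩
  ι q          ∎
  where
  open ℚ.≤-Reasoning
  0<½ : 0ℚ < ½
  0<½ = ℚ.*<* (ℤ.+<+ (ℕ.s≤s ℕ.z≤n))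
  ½<1 : ½ < ι 1
  ½<1 = ℚ.*<* (ℤ.+<+ ℕ.≤-refl)

-ᵣ-<-fromℕᵣ : ∀ x y p q r → x <ᵣ fromℕᵣ p → fromℕᵣ q ≤ᵣ y → p ℕ.≤ q ℕ.+ r → x -ᵣ y <ᵣ fromℕᵣ r
-ᵣ-<-fromℕᵣ x y p q r x<p q≤y p≤q+r =
  <ᵣ-combine x (fromℕᵣ p) (fromℕᵣ q) y (x -ᵣ y) (fromℕᵣ r) x<p q≤y λ n →
    let X = seq x n; Y = seq y n; open ℚ.≤-Reasoning in begin
    (ι p - X) + (Y - ι q)
      ≡⟨ solve 4 (λ u v P Q → (P :- u) :+ (v :- Q) := P :+ (v :- u :- Q)) refl X Y (ι p) (ι q) ⟩
    ι p + (Y - X - ι q)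
      ≤⟨ ℚ.+-monoˡ-≤ (Y - X - ι q) (ι-sum-≤ p q r p≤q+r) ⟩
    (ι q + ι r) + (Y - X - ι q)
      ≡⟨ solve 4 (λ u v Q R → (Q :+ R) :+ (v :- u :- Q) := R :- (u :- v)) refl X Y (ι q) (ι r) ⟩
    ι r - (X - Y) ∎

fromℕᵣ-<--ᵣ : ∀ x y p q r → fromℕᵣ p ≤ᵣ x → y <ᵣ fromℕᵣ q → q ℕ.+ r ℕ.≤ p → fromℕᵣ r <ᵣ x -ᵣ y
fromℕᵣ-<--ᵣ x y p q r p≤x y<q q+r≤p =
  <ᵣ-combine y (fromℕᵣ q) (fromℕᵣ p) x (fromℕᵣ r) (x -ᵣ y) y<q p≤x λ n →
    let X = seq x n; Y = seq y n; open ℚ.≤-Reasoning in begin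
    (ι q - Y) + (X - ι p)
      ≡⟨ solve 5 (λ u v P Q R → (Q :- v) :+ (u :- P) := (Q :+ R) :+ (u :- v :- P :- R))
           refl X Y (ι p) (ι q) (ι r) ⟩
    (ι q + ι r) + (X - Y - ι p - ι r)
      ≤⟨ ℚ.+-monoˡ-≤ (X - Y - ι p - ι r) (ι-sum-≥ p q r q+r≤p) ⟩
    ι p + (X - Y - ι p - ι r)
      ≡⟨ solve 4 (λ u v P R → P :+ (u :- v :- P :- R) := (u :- v) :- R) refl X Y (ι p) (ι r) ⟩
    (X - Y) - ι r ∎

<-fromℕᵣ-+ : ∀ x y p q → x -ᵣ y ≤ᵣ fromℕᵣ q → y <ᵣ fromℕᵣ p → x <ᵣ fromℕᵣ (p ℕ.+ q)
<-fromℕᵣ-+ x y p q x-y≤q y<p =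
  <ᵣ-combine y (fromℕᵣ p) (x -ᵣ y) (fromℕᵣ q) x (fromℕᵣ (p ℕ.+ q)) y<p x-y≤q λ n →
    let X = seq x n; Y = seq y n; open ℚ.≤-Reasoning in begin
    (ι p - Y) + (ι q - (X - Y))
      ≡⟨ solve 4 (λ u v P Q → (P :- v) :+ (Q :- (u :- v)) := (P :+ Q) :- u) refl X Y (ι p) (ι q) ⟩
    (ι p + ι q) - X
      ≡⟨ cong (_- X) (ι-homo-+ p q) ⟨
    ι (p ℕ.+ q) - X ∎

-- Translating bounded modalities

-- Future and past modalities are mirror images, so the translation is done once with the direction
-- as a parameter.
data Direction : Set where
  future past : Direction

opposite : Direction → Direction
opposite future = past
opposite past   = future

Before : Direction → Fin n → Fin n → Set
Before future i j = i Fin.< j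
Before past   i j = j Fin.< i

before-opposite : ∀ d {i j : Fin n} → Before (opposite d) i j → Before d j i
before-opposite future = id
before-opposite past   = id

before-wellFounded : ∀ d → WellFounded (Before {n} d)
before-wellFounded future = Fin.<-wellFounded
before-wellFounded past   = Fin.>-wellFounded

before-connex : ∀ d {i j : Fin n} → ¬ Before (opposite d) i j → i ≡ j ⊎ Before d i j
before-connex d {i} {j} ¬after with d | Fin.<-cmp i j
... | future | tri< i<j _ _ = inj₂ i<j
... | future | tri≈ _ i≡j _ = inj₁ i≡j
... | future | tri> _ _ j<i = contradiction j<i ¬after
... | past   | tri< i<j _ _ = contradiction i<j ¬after
... | past   | tri≈ _ i≡j _ = inj₁ i≡j
... | past   | tri> _ _ j<i = inj₂ j<i

dist : Direction → ℝ → ℝ → ℝ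
dist future s t = t -ᵣ s
dist past   s t = s -ᵣ t

-- For a current position in unit `k` and a target in unit `m`, these are the units of the
-- temporally first and last of the two.
early late : Direction → ℕ → ℕ → ℕ
early future k m = k
early past   k m = m
late  future k m = m
late  past   k m = k

record InUnit (k : ℕ) (t : ℝ) : Set where
  constructor inUnit
  field
    lower : fromℕᵣ k ≤ᵣ t
    upper : t <ᵣ fromℕᵣ (suc k)

-- Units are half-open: the `late` stamp is strictly below the end of its unit and the `early` one
-- at least the start of its own, so the distance is strictly below `late - early + 1`.
dist-upper : ∀ d {k m u s t} → InUnit k s → InUnit m t →
  late d k m ℕ.< early d k m ℕ.+ u → dist d s t <ᵣ fromℕᵣ u
dist-upper future {k} {m} {u} {s} {t} (inUnit k≤s _) (inUnit _ t<m) = -ᵣ-<-fromℕᵣ t s (suc m) k u t<m k≤s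
dist-upper past   {k} {m} {u} {s} {t} (inUnit _ s<k) (inUnit m≤t _) = -ᵣ-<-fromℕᵣ s t (suc k) m u s<k m≤t

dist-lower : ∀ d {k m l s t} → InUnit k s → InUnit m t →
  early d k m ℕ.+ l ℕ.< late d k m → fromℕᵣ l <ᵣ dist d s t
dist-lower future {k} {m} {l} {s} {t} (inUnit _ s<k) (inUnit m≤t _) = fromℕᵣ-<--ᵣ t s m (suc k) l m≤t s<k
dist-lower past   {k} {m} {l} {s} {t} (inUnit k≤s _) (inUnit _ t<m) = fromℕᵣ-<--ᵣ s t k (suc m) l k≤s t<m

-- The last unit a target can lie in: a future target within distance `u` has a stamp below
-- `k + 1 + u`, a past one is no later than the current position.
lastUnit : Direction → ℕ → ℕ → ℕ
lastUnit future k u = k ℕ.+ u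
lastUnit past   k u = k

-- The target fragment can only bound distances from below, so an upper bound becomes the negation
-- of a lower bound with the other bracket.
flip : Bracket → Bracket
flip closed = open′
flip open′  = closed

<ᵣ⇒≲ : ∀ b x y → x <ᵣ y → x ≲[ b ] y
<ᵣ⇒≲ closed x y = <ᵣ⇒≤ᵣ x y
<ᵣ⇒≲ open′  x y = id

≲⇒≤ᵣ : ∀ b x y → x ≲[ b ] y → x ≤ᵣ y
≲⇒≤ᵣ closed x y = id
≲⇒≤ᵣ open′  x y = <ᵣ⇒≤ᵣ x y

≤-≲-trans : ∀ b x y z → x ≤ᵣ y → y ≲[ b ] z → x ≲[ b ] z
≤-≲-trans closed = ≤ᵣ-trans
≤-≲-trans open′  = ≤-<ᵣ-trans

≲-flip : ∀ b x y → x ≲[ b ] y → ¬ (y ≲[ flip b ] x)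
≲-flip closed x y x≤y y<x = x≤y y<x
≲-flip open′  x y x<y y≤x = y≤x x<y

monotone : (f : Fin (suc n) → ℝ) → (∀ i → f (inject₁ i) ≤ᵣ f (suc i)) →
  ∀ i j → i Fin.≤ j → f i ≤ᵣ f j
monotone {zero}  f step zero    zero    _         = ≤ᵣ-refl (f zero)
monotone {suc n} f step zero    zero    _         = ≤ᵣ-refl (f zero)
monotone {suc n} f step zero    (suc j) _         =
  ≤ᵣ-trans (f zero) (f (suc zero)) (f (suc j)) (step zero)
    (monotone (f ∘ suc) (step ∘ suc) zero j ℕ.z≤n)
monotone {suc n} f step (suc i) (suc j) (ℕ.s≤s i≤j) =
  monotone (f ∘ suc) (step ∘ suc) i j i≤j

-- Time stamps, units and distances in a timed word

module _ (ρ : TimedWord A) where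

  time-mono : ∀ {i j} → i Fin.≤ j → time ρ i ≤ᵣ time ρ j
  time-mono {i} {j} = monotone (time ρ)
    (λ i → <ᵣ⇒≤ᵣ (time ρ (inject₁ i)) (time ρ (suc i)) (increasing ρ i)) i j

  time-nonneg : ∀ i → fromℕᵣ 0 ≤ᵣ time ρ i
  time-nonneg i = ≤ᵣ-trans (fromℕᵣ 0) (time ρ zero) (time ρ i)
    (proj₂ (starts-at-0 ρ)) (time-mono {zero} {i} ℕ.z≤n)

  time-cancel-< : ∀ {i j} → time ρ i <ᵣ time ρ j → i Fin.< j
  time-cancel-< {i} {j} ti<tj = ℕ.≰⇒> λ j≤i → time-mono {j} {i} j≤i ti<tj

  unit-start : InUnit 0 (time ρ zero)
  unit-start = inUnit (time-nonneg zero) (≤-<ᵣ-trans (time ρ zero) (fromℕᵣ 0) (fromℕᵣ 1)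
    (proj₁ (starts-at-0 ρ)) (fromℕᵣ-mono-< {0} {1} ℕ.≤-refl))

  before-unit : ∀ {i j k m} → InUnit k (time ρ i) → InUnit m (time ρ j) → k ℕ.< m → i Fin.< j
  before-unit {i} {j} {k} {m} (inUnit _ ti<) (inUnit ≤tj _) k<m = time-cancel-<
    (<-≤ᵣ-trans (time ρ i) (fromℕᵣ (suc k)) (time ρ j) ti<
      (≤ᵣ-trans (fromℕᵣ (suc k)) (fromℕᵣ m) (time ρ j) (fromℕᵣ-mono-≤ {suc k} {m} k<m) ≤tj))

  before-units : ∀ d {i j k m} → InUnit k (time ρ i) → InUnit m (time ρ j) →
    early d k m ℕ.< late d k m → Before d i j
  before-units future i∈k j∈m = before-unit i∈k j∈m
  before-units past   i∈k j∈m = before-unit j∈m i∈k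

  dist-nonneg : ∀ d {i j} → Before d i j → fromℕᵣ 0 ≤ᵣ dist d (time ρ i) (time ρ j)
  dist-nonneg future {i} {j} i<j = x≤y⇒0≤y-x (time ρ i) (time ρ j) (time-mono (ℕ.<⇒≤ i<j))
  dist-nonneg past   {i} {j} j<i = x≤y⇒0≤y-x (time ρ j) (time ρ i) (time-mono (ℕ.<⇒≤ j<i))

  dist-mono : ∀ d i {j k} → j ≡ k ⊎ Before d j k →
    dist d (time ρ i) (time ρ j) ≤ᵣ dist d (time ρ i) (time ρ k)
  dist-mono d      i {j}     (inj₁ refl) = ≤ᵣ-refl (dist d (time ρ i) (time ρ j))
  dist-mono future i {j} {k} (inj₂ j<k) =
    -ᵣ-monoˡ-≤ (time ρ j) (time ρ k) (time ρ i) (time-mono (ℕ.<⇒≤ j<k))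
  dist-mono past   i {j} {k} (inj₂ k<j) =
    -ᵣ-monoʳ-≤ (time ρ k) (time ρ j) (time ρ i) (time-mono (ℕ.<⇒≤ k<j))

  lastUnit-bound : ∀ d {i j k u} → Before d i j → InUnit k (time ρ i) →
    dist d (time ρ i) (time ρ j) ≤ᵣ fromℕᵣ u → time ρ j <ᵣ fromℕᵣ (suc (lastUnit d k u))
  lastUnit-bound future {i} {j} {k} {u} _ (inUnit _ ti<) δ≤u =
    <-fromℕᵣ-+ (time ρ j) (time ρ i) (suc k) u δ≤u ti<
  lastUnit-bound past   {i} {j} {k} j<i (inUnit _ ti<) _ =
    ≤-<ᵣ-trans (time ρ j) (time ρ i) (fromℕᵣ (suc k)) (time-mono (ℕ.<⇒≤ j<i)) ti<

  Dia : Direction → Interval → Pred (Position ρ) 0ℓ → Pred (Position ρ) 0ℓ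
  Dia d I P i = ∃ λ j → Before d i j × dist d (time ρ i) (time ρ j) ∈ᵢ I × P j

  Dia-cong : ∀ d I i {P Q : Pred (Position ρ) 0ℓ} → (∀ j → P j ⇔ Q j) → Dia d I P i ⇔ Dia d I Q i
  Dia-cong d I i P⇔Q = mk⇔
    (λ (j , i→j , δ∈I , Pj) → j , i→j , δ∈I , to (P⇔Q j) Pj)
    (λ (j , i→j , δ∈I , Qj) → j , i→j , δ∈I , from (P⇔Q j) Qj)

  -- Stamps are non-negative, so a witness at distance `k` forces the stamp up to `k`; conversely
  -- the start is a witness. As `𝖯` is strict, `0 < k` is what puts the start strictly before `i`.
  since-start : ∀ k → 0 ℕ.< k → ∀ i {P : Pred (Position ρ) 0ℓ} → P zero →
    Dia past ⟨ closed , k ,∞⟩ P i ⇔ fromℕᵣ k ≤ᵣ time ρ i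
  since-start k 0<k i {P} P0 = mk⇔ fwd bwd
    where
    fwd : Dia past ⟨ closed , k ,∞⟩ P i → fromℕᵣ k ≤ᵣ time ρ i
    fwd (j , _ , k≤δ , _) = x≤y-t∧0≤t⇒x≤y (fromℕᵣ k) (time ρ i) (time ρ j) k≤δ (time-nonneg j)

    bwd : fromℕᵣ k ≤ᵣ time ρ i → Dia past ⟨ closed , k ,∞⟩ P i
    bwd k≤ = zero , time-cancel-< start< ,
      x≤y∧t≤0⇒x≤y-t (fromℕᵣ k) (time ρ i) (time ρ zero) k≤ (proj₁ (starts-at-0 ρ)) , P0
      where
      start< : time ρ zero <ᵣ time ρ i
      start< = <-≤ᵣ-trans (time ρ zero) (fromℕᵣ k) (time ρ i)
        (≤-<ᵣ-trans (time ρ zero) (fromℕᵣ 0) (fromℕᵣ k) (proj₁ (starts-at-0 ρ)) (fromℕᵣ-mono-< 0<k)) k≤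

-- Construction of the translated formula

infixr 7 _∧ᶠ_
_∧ᶠ_ : Formula K A → Formula K A → Formula K A
φ ∧ᶠ ψ = ¬ᶠ ((¬ᶠ φ) ∨ᶠ (¬ᶠ ψ))

-- Truth is not primitive and is built from an atom; every formula contains a letter to build it
-- from.
someLetter : Formula K A → A
someLetter (atom a)  = a
someLetter (φ ∨ᶠ _)  = someLetter φ
someLetter (¬ᶠ φ)    = someLetter φ
someLetter (𝖥 _ _ φ) = someLetter φ
someLetter (𝖯 _ _ φ) = someLetter φ

dia≥ : Direction → Bracket → ℕ → Formula MITL[F∞,P∞] A → Formula MITL[F∞,P∞] A
dia≥ future b l = 𝖥 ⟨ b , l ,∞⟩ tt
dia≥ past   b l = 𝖯 ⟨ b , l ,∞⟩ tt

⊨dia : ∀ d b l (ρ : TimedWord A) φ i →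
  ρ at i ⊨ dia≥ d b l φ ⇔ Dia ρ d ⟨ b , l ,∞⟩ (ρ at_⊨ φ) i
⊨dia future b l ρ φ i = ⇔-id _
⊨dia past   b l ρ φ i = ⇔-id _

-- The negated modality also looks past the current position. This is harmless where it is used:
-- there `ψ` is confined to a unit lying entirely in direction `d` of the current one.
nearestᶠ : Direction → Formula MITL[F∞,P∞] A → Formula MITL[F∞,P∞] A
nearestᶠ d ψ = ψ ∧ᶠ (¬ᶠ dia≥ (opposite d) closed 0 ψ)

-- The formula replaces a bounded modality evaluated in the unit [k, k+1) whose
-- argument ψ holds only in the unit [m, m+1). Distances between the two units
-- lie in an open interval of length 2 around the integer late − early, so since
-- l < u at most one of the two bounds is not automatic. The lower bound can be
-- imposed directly; the upper bound holds for some ψ-position iff it does not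
-- fail for the nearest ψ-position, which is the one with no ψ on its near side.
diaInto : ∀ d → Bracket → (l u : ℕ) → Bracket → ∀ k m → Dec (late d k m ℕ.≤ early d k m ℕ.+ l) →
  Formula MITL[F∞,P∞] A → Formula MITL[F∞,P∞] A
diaInto d b l u b′ k m (yes _) ψ = dia≥ d b l ψ
diaInto d b l u b′ k m (no _)  ψ =
  dia≥ d closed 0 ψ ∧ᶠ (¬ᶠ dia≥ d (flip b′) u (nearestᶠ d ψ))

module Translation {A : Set} (a₀ : A) where

  ⊤ᶠ : Formula MITL[F∞,P∞] A
  ⊤ᶠ = atom a₀ ∨ᶠ (¬ᶠ atom a₀)

  ⋁ : ℕ → (ℕ → Formula MITL[F∞,P∞] A) → Formula MITL[F∞,P∞] A
  ⋁ zero    φ = ¬ᶠ ⊤ᶠ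
  ⋁ (suc n) φ = φ n ∨ᶠ ⋁ n φ

  atLeast : ℕ → Formula MITL[F∞,P∞] A
  -- A past modality is strict, so at the start it would fail even with the interval `[0,∞)`.
  atLeast zero      = ⊤ᶠ
  atLeast k@(suc _) = dia≥ past closed k ⊤ᶠ

  unit : ℕ → Formula MITL[F∞,P∞] A
  unit k = atLeast k ∧ᶠ (¬ᶠ atLeast (suc k))

  -- The guard `unit m` confines each argument to a single unit, as `diaInto` requires, and ensures
  -- that `φ m` is consulted only in the unit it is meant for.
  diaBounded : Direction → Bracket → (l u : ℕ) → Bracket → ℕ → (ℕ → Formula MITL[F∞,P∞] A) →
    Formula MITL[F∞,P∞] A
  diaBounded d b l u b′ k φ = ⋁ (suc (lastUnit d k u)) λ m →
    diaInto d b l u b′ k m (late d k m ℕ.≤? early d k m ℕ.+ l) (unit m ∧ᶠ φ m)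

  -- tr k φ is meant for positions with time stamp in [k, k+1).
  tr : ℕ → Formula BoundedMITL[Fb,Pb] A → Formula MITL[F∞,P∞] A
  tr k (atom a)                    = atom a
  tr k (φ ∨ᶠ ψ)                    = tr k φ ∨ᶠ tr k ψ
  tr k (¬ᶠ φ)                      = ¬ᶠ tr k φ
  tr k (𝖥 ⟨ b , l , u , b′ ⟩ _ φ) = diaBounded future b l u b′ k λ m → tr m φ
  tr k (𝖯 ⟨ b , l , u , b′ ⟩ _ φ) = diaBounded past b l u b′ k λ m → tr m φ

-- Correctness of the translation

module Classical (em : ExcludedMiddle 0ℓ) where

  stable : {P : Set} → ¬ ¬ P → P
  stable = decidable-stable em

  -- For `closed` this is the definition of `≤ᵣ`; for `open′` it is double negation elimination for
  -- `<ᵣ`.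
  ≲-unflip : ∀ b x y → ¬ (y ≲[ flip b ] x) → x ≲[ b ] y
  ≲-unflip closed x y y≮x = y≮x
  ≲-unflip open′  x y y≰x = stable y≰x

  -- The bound is lowered one unit at a time; comparing a Cauchy real with an integer is
  -- undecidable, hence the appeal to `em`.
  floor : ∀ n {t} → fromℕᵣ 0 ≤ᵣ t → t <ᵣ fromℕᵣ (suc n) → ∃ λ m → m ℕ.< suc n × InUnit m t
  floor zero    0≤t t<1 = 0 , ℕ.≤-refl , inUnit 0≤t t<1
  floor (suc n) {t} 0≤t t<2+n with em {t <ᵣ fromℕᵣ (suc n)}
  ... | yes t<1+n with (m , m<1+n , t∈m) ← floor n {t} 0≤t t<1+n = m , ℕ.m<n⇒m<1+n m<1+n , t∈m
  ... | no  t≮1+n = suc n , ℕ.≤-refl , inUnit t≮1+n t<2+n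

  -- Move to a nearer `P`-position as long as one exists, which `em` decides; finiteness of the word
  -- makes this well-founded.
  nearest : ∀ d (P : Pred (Fin n) 0ℓ) {j} → P j →
    ∃ λ j₀ → P j₀ × ∀ {j′} → P j′ → ¬ Before (opposite d) j₀ j′
  nearest {n} d P {j} = go (before-wellFounded d j)
    where
    go : ∀ {j} → Acc (Before d) j → P j → ∃ λ j₀ → P j₀ × ∀ {j′} → P j′ → ¬ Before (opposite d) j₀ j′
    go {j} (acc rec) Pj with em {∃ λ j′ → P j′ × Before (opposite d) j j′}
    ... | yes (j′ , Pj′ , j′-nearer) = go (rec (before-opposite d j′-nearer)) Pj′
    ... | no  none = j , Pj , λ Pj′ j′-nearer → none (_ , Pj′ , j′-nearer)

  module _ (ρ : TimedWord A) where

    Nearest : Direction → Pred (Position ρ) 0ℓ → Pred (Position ρ) 0ℓ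
    Nearest d P j = P j × ¬ Dia ρ (opposite d) ⟨ closed , 0 ,∞⟩ P j

    module _ (d : Direction) (b : Bracket) (l u : ℕ) (b′ : Bracket) (l<u : l ℕ.< u)
             {k m : ℕ} {i : Position ρ} (i∈k : InUnit k (time ρ i))
             (P : Pred (Position ρ) 0ℓ) (P⊆m : ∀ {j} → P j → InUnit m (time ρ j)) where

      private
        δ : Position ρ → ℝ
        δ j = dist d (time ρ i) (time ρ j)

      upper-automatic : late d k m ℕ.≤ early d k m ℕ.+ l →
        Dia ρ d ⟨ b , l ,∞⟩ P i ⇔ Dia ρ d ⟨ b , l , u , b′ ⟩ P i
      upper-automatic late≤ = mk⇔
        (λ (j , i→j , l≲δ , Pj) → j , i→j , (l≲δ , <ᵣ⇒≲ b′ (δ j) (fromℕᵣ u) (δ<u Pj)) , Pj)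
        (λ (j , i→j , (l≲δ , _) , Pj) → j , i→j , l≲δ , Pj)
        where
        δ<u : ∀ {j} → P j → δ j <ᵣ fromℕᵣ u
        -- Non-singularity enters here: `l < u` leaves room for the whole width of the two units.
        δ<u Pj = dist-upper d i∈k (P⊆m Pj) (ℕ.≤-<-trans late≤ (ℕ.+-monoʳ-< (early d k m) l<u))

      lower-automatic : early d k m ℕ.+ l ℕ.< late d k m →
        (Dia ρ d ⟨ closed , 0 ,∞⟩ P i × ¬ Dia ρ d ⟨ flip b′ , u ,∞⟩ (Nearest d P) i) ⇔
        Dia ρ d ⟨ b , l , u , b′ ⟩ P i
      lower-automatic early+l<late = mk⇔ fwd bwd
        where
        nearest-works : ¬ Dia ρ d ⟨ flip b′ , u ,∞⟩ (Nearest d P) i →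
          (∃ λ j₀ → P j₀ × ∀ {j′} → P j′ → ¬ Before (opposite d) j₀ j′) →
          Dia ρ d ⟨ b , l , u , b′ ⟩ P i
        nearest-works noFar (j₀ , Pj₀ , none) = j₀ , i→j₀ ,
          ( <ᵣ⇒≲ b (fromℕᵣ l) (δ j₀) (dist-lower d i∈k (P⊆m Pj₀) early+l<late)
          , ≲-unflip b′ (δ j₀) (fromℕᵣ u) notFar ) , Pj₀
          where
          i→j₀ : Before d i j₀
          i→j₀ = before-units ρ d i∈k (P⊆m Pj₀) (ℕ.≤-<-trans (ℕ.m≤m+n _ l) early+l<late)

          notFar : ¬ (fromℕᵣ u ≲[ flip b′ ] δ j₀)
          notFar far = noFar (j₀ , i→j₀ , far , Pj₀ , λ (_ , nearer , _ , Pj′) → none Pj′ nearer)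

        fwd : Dia ρ d ⟨ closed , 0 ,∞⟩ P i × ¬ Dia ρ d ⟨ flip b′ , u ,∞⟩ (Nearest d P) i →
              Dia ρ d ⟨ b , l , u , b′ ⟩ P i
        -- The first conjunct only supplies some `P`-position from which to search for the nearest
        -- one.
        fwd ((_ , _ , _ , Pj) , noFar) = nearest-works noFar (nearest d P Pj)

        bwd : Dia ρ d ⟨ b , l , u , b′ ⟩ P i →
              Dia ρ d ⟨ closed , 0 ,∞⟩ P i × ¬ Dia ρ d ⟨ flip b′ , u ,∞⟩ (Nearest d P) i
        bwd (j , i→j , (_ , δ≲u) , Pj) = (j , i→j , dist-nonneg ρ d i→j , Pj) , noFar
          where
          noFar : ¬ Dia ρ d ⟨ flip b′ , u ,∞⟩ (Nearest d P) i
          -- A nearest `P`-position is no farther away than `j`, so it inherits the upper bound that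
          -- `j` satisfies.
          noFar (j₀ , _ , far , _ , none) =
            ≲-flip b′ (δ j₀) (fromℕᵣ u) (≤-≲-trans b′ (δ j₀) (δ j) (fromℕᵣ u) δ₀≤δ δ≲u) far
            where
            ¬j-nearer : ¬ Before (opposite d) j₀ j
            ¬j-nearer nearer = none (j , nearer , dist-nonneg ρ (opposite d) nearer , Pj)

            δ₀≤δ : δ j₀ ≤ᵣ δ j
            δ₀≤δ = dist-mono ρ d i {j₀} {j} (before-connex d ¬j-nearer)

    ⊨∧ : (φ ψ : Formula K A) → ∀ i → ρ at i ⊨ φ ∧ᶠ ψ ⇔ (ρ at i ⊨ φ × ρ at i ⊨ ψ)
    ⊨∧ φ ψ i = mk⇔
      (λ ¬∨ → stable (¬∨ ∘ inj₁) , stable (¬∨ ∘ inj₂))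
      (λ (x , y) → [ (λ ¬x → ¬x x) , (λ ¬y → ¬y y) ])

    ⊨nearestᶠ : ∀ d ψ j → ρ at j ⊨ nearestᶠ d ψ ⇔ Nearest d (ρ at_⊨ ψ) j
    ⊨nearestᶠ d ψ j = (⇔-id _ ×-⇔ ¬-cong-⇔ (⊨dia (opposite d) closed 0 ρ ψ j))
      ⇔-∘ ⊨∧ ψ (¬ᶠ dia≥ (opposite d) closed 0 ψ) j

    ⊨diaInto : ∀ d b l u b′ → l ℕ.< u → ∀ {k m i} → InUnit k (time ρ i) →
      ∀ ψ → (∀ {j} → ρ at j ⊨ ψ → InUnit m (time ρ j)) → ∀ dec →
      ρ at i ⊨ diaInto d b l u b′ k m dec ψ ⇔ Dia ρ d ⟨ b , l , u , b′ ⟩ (ρ at_⊨ ψ) i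
    ⊨diaInto d b l u b′ l<u {i = i} i∈k ψ ψ⊆m (yes late≤) =
      upper-automatic d b l u b′ l<u i∈k (ρ at_⊨ ψ) ψ⊆m late≤ ⇔-∘ ⊨dia d b l ρ ψ i
    ⊨diaInto d b l u b′ l<u {i = i} i∈k ψ ψ⊆m (no late≰) =
      lower-automatic d b l u b′ l<u i∈k (ρ at_⊨ ψ) ψ⊆m (ℕ.≰⇒> late≰)
      ⇔-∘ ((⊨dia d closed 0 ρ ψ i ×-⇔ ¬-cong-⇔
        (Dia-cong ρ d ⟨ flip b′ , u ,∞⟩ i (⊨nearestᶠ d ψ) ⇔-∘ ⊨dia d (flip b′) u ρ (nearestᶠ d ψ) i))
      ⇔-∘ ⊨∧ (dia≥ d closed 0 ψ) (¬ᶠ dia≥ d (flip b′) u (nearestᶠ d ψ)) i)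

  module _ {A : Set} (a₀ : A) (ρ : TimedWord A) where
    open Translation a₀

    ⊨⊤ : ∀ {i} → ρ at i ⊨ ⊤ᶠ
    ⊨⊤ {i} with em {letter ρ i ≡ a₀}
    ... | yes eq = inj₁ eq
    ... | no neq = inj₂ neq

    ⊨⋁ : ∀ n φ {i} → ρ at i ⊨ ⋁ n φ ⇔ (∃ λ m → m ℕ.< n × ρ at i ⊨ φ m)
    ⊨⋁ zero    φ = mk⇔ (λ ¬⊤ → contradiction ⊨⊤ ¬⊤) λ ()
    ⊨⋁ (suc n) φ {i} = mk⇔ fwd bwd
      where
      fwd : ρ at i ⊨ ⋁ (suc n) φ → ∃ λ m → m ℕ.< suc n × ρ at i ⊨ φ m
      fwd (inj₁ h) = n , ℕ.≤-refl , h
      fwd (inj₂ h) with (m , m<n , h′) ← to (⊨⋁ n φ) h = m , ℕ.m<n⇒m<1+n m<n , h′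

      bwd : (∃ λ m → m ℕ.< suc n × ρ at i ⊨ φ m) → ρ at i ⊨ ⋁ (suc n) φ
      bwd (m , ℕ.s≤s m≤n , h) with ℕ.m≤n⇒m<n∨m≡n m≤n
      ... | inj₁ m<n  = inj₂ (from (⊨⋁ n φ) (m , m<n , h))
      ... | inj₂ refl = inj₁ h

    ⊨atLeast : ∀ k {i} → ρ at i ⊨ atLeast k ⇔ fromℕᵣ k ≤ᵣ time ρ i
    ⊨atLeast zero    {i} = mk⇔ (λ _ → time-nonneg ρ i) (λ _ → ⊨⊤)
    ⊨atLeast (suc k) {i} = since-start ρ (suc k) (ℕ.s≤s ℕ.z≤n) i ⊨⊤

    ⊨unit : ∀ k {i} → ρ at i ⊨ unit k ⇔ InUnit k (time ρ i)
    ⊨unit k {i} = mk⇔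
      (λ (lo , hi) → inUnit lo (stable hi))
      (λ (inUnit lo hi) → lo , λ ≥1+k → ≥1+k hi)
      ⇔-∘ ((⊨atLeast k ×-⇔ ¬-cong-⇔ (⊨atLeast (suc k)))
      ⇔-∘ ⊨∧ ρ (atLeast k) (¬ᶠ atLeast (suc k)) i)

    -- The hypothesis on `φ` asks for correctness of `φ m` only inside unit `m`, which is the form
    -- of the induction hypothesis in `tr-correct`.
    ⊨diaBounded : ∀ d b l u b′ → l ℕ.< u → ∀ {k} {P : Pred (Position ρ) 0ℓ} φ →
      (∀ m j → InUnit m (time ρ j) → P j ⇔ ρ at j ⊨ φ m) →
      ∀ {i} → InUnit k (time ρ i) →
      Dia ρ d ⟨ b , l , u , b′ ⟩ P i ⇔ ρ at i ⊨ diaBounded d b l u b′ k φ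
    ⊨diaBounded d b l u b′ l<u {k} {P} φ P⇔φ {i} i∈k = mk⇔ fwd bwd
      where
      N = suc (lastUnit d k u)

      χ : ℕ → Formula MITL[F∞,P∞] A
      χ m = unit m ∧ᶠ φ m

      dec : ∀ m → Dec (late d k m ℕ.≤ early d k m ℕ.+ l)
      dec m = late d k m ℕ.≤? early d k m ℕ.+ l

      disjunct : ℕ → Formula MITL[F∞,P∞] A
      disjunct m = diaInto d b l u b′ k m (dec m) (χ m)

      ⊨χ : ∀ m j → ρ at j ⊨ χ m ⇔ (InUnit m (time ρ j) × ρ at j ⊨ φ m)
      ⊨χ m j = (⊨unit m {j} ×-⇔ ⇔-id _) ⇔-∘ ⊨∧ ρ (unit m) (φ m) j

      ⊨disjunct : ∀ m → ρ at i ⊨ disjunct m ⇔ Dia ρ d ⟨ b , l , u , b′ ⟩ (λ j → InUnit m (time ρ j) × ρ at j ⊨ φ m) i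
      ⊨disjunct m = Dia-cong ρ d ⟨ b , l , u , b′ ⟩ i (⊨χ m)
        ⇔-∘ ⊨diaInto ρ d b l u b′ l<u {k} {m} i∈k (χ m) (λ {j} → proj₁ ∘ to (⊨χ m j)) (dec m)

      fwd : Dia ρ d ⟨ b , l , u , b′ ⟩ P i → ρ at i ⊨ ⋁ N disjunct
      fwd (j , i→j , (l≲δ , δ≲u) , Pj) =
        -- The upper bound of the interval places the target in one of the finitely many units of
        -- the disjunction.
        let (m , m<N , j∈m) = floor (lastUnit d k u) {time ρ j} (time-nonneg ρ j)
              (lastUnit-bound ρ d i→j i∈k (≲⇒≤ᵣ b′ (dist d (time ρ i) (time ρ j)) (fromℕᵣ u) δ≲u))
        in from (⊨⋁ N disjunct) (m , m<N , from (⊨disjunct m)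
             (j , i→j , (l≲δ , δ≲u) , j∈m , to (P⇔φ m j j∈m) Pj))

      drop-unit : ∀ m → Dia ρ d ⟨ b , l , u , b′ ⟩ (λ j → InUnit m (time ρ j) × ρ at j ⊨ φ m) i →
        Dia ρ d ⟨ b , l , u , b′ ⟩ P i
      drop-unit m (j , i→j , δ∈I , j∈m , ⊨φ) = j , i→j , δ∈I , from (P⇔φ m j j∈m) ⊨φ

      bwd : ρ at i ⊨ ⋁ N disjunct → Dia ρ d ⟨ b , l , u , b′ ⟩ P i
      bwd h = let (m , _ , h′) = to (⊨⋁ N disjunct) h in drop-unit m (to (⊨disjunct m) h′)

    -- Induction on `φ` for all units and positions at once, since a modality passes to targets in
    -- other units.
    tr-correct : ∀ φ k i → InUnit k (time ρ i) → ρ at i ⊨ φ ⇔ ρ at i ⊨ tr k φ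
    tr-correct (atom a) k i i∈k = ⇔-id _
    tr-correct (φ ∨ᶠ ψ) k i i∈k = tr-correct φ k i i∈k ⊎-⇔ tr-correct ψ k i i∈k
    tr-correct (¬ᶠ φ)   k i i∈k = ¬-cong-⇔ (tr-correct φ k i i∈k)
    tr-correct (𝖥 ⟨ b , l , u , b′ ⟩ l<u φ) k i i∈k =
      ⊨diaBounded future b l u b′ l<u (λ m → tr m φ) (tr-correct φ) i∈k
    tr-correct (𝖯 ⟨ b , l , u , b′ ⟩ l<u φ) k i i∈k =
      ⊨diaBounded past b l u b′ l<u (λ m → tr m φ) (tr-correct φ) i∈k

  bounded⊆lowerBounded : BoundedMITL[Fb,Pb] ⊆ₑ MITL[F∞,P∞]
  bounded⊆lowerBounded {A} _ L (φ , L⊆φ , φ⊆L) =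
    -- Words start at time 0, so the formula is translated for unit 0.
    tr 0 φ , (λ {ρ} ρ∈L → to (correct ρ) (L⊆φ ρ∈L)) , (λ {ρ} h → φ⊆L (from (correct ρ) h))
    where
    a₀ = someLetter φ
    open Translation a₀
    correct : ∀ ρ → ρ at zero ⊨ φ ⇔ ρ at zero ⊨ tr 0 φ
    correct ρ = tr-correct a₀ ρ φ 0 zero (unit-start ρ)

-- Strictness

singleton : TimedWord ⊤
singleton = record
  { pred-length = 0
  ; letter      = λ _ → tt
  ; time        = λ _ → fromℕᵣ 0
  ; starts-at-0 = ≤ᵣ-refl (fromℕᵣ 0) , ≤ᵣ-refl (fromℕᵣ 0)
  ; increasing  = λ ()
  }

pair : ∀ t → 0 ℕ.< t → TimedWord ⊤
pair t 0<t = record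
  { pred-length = 1
  ; letter      = λ _ → tt
  ; time        = λ { zero → fromℕᵣ 0 ; (suc _) → fromℕᵣ t }
  ; starts-at-0 = ≤ᵣ-refl (fromℕᵣ 0) , ≤ᵣ-refl (fromℕᵣ 0)
  ; increasing  = λ { zero → fromℕᵣ-mono-< 0<t }
  }

-- Only outermost modalities count: at the first position a past modality has no target, and a
-- future one whose targets are all out of reach fails whatever its argument.
horizon : Formula BoundedMITL[Fb,Pb] A → ℕ
horizon (atom _)                    = 0
horizon (φ ∨ᶠ ψ)                    = horizon φ ℕ.⊔ horizon ψ
horizon (¬ᶠ φ)                      = horizon φ
horizon (𝖥 ⟨ _ , _ , u , _ ⟩ _ _) = u
horizon (𝖯 _ _ _)                   = 0

-- The bound `y < 1` supplies the strict inequality that `fromℕᵣ-<--ᵣ` asks for; `u < t` is by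
-- definition `1 + u ≤ t`.
out-of-reach : ∀ b x y {t u} → fromℕᵣ t ≤ᵣ x → y <ᵣ fromℕᵣ 1 → u ℕ.< t → ¬ ((x -ᵣ y) ≲[ b ] fromℕᵣ u)
out-of-reach b x y {t} {u} t≤x y<1 u<t δ≲u =
  ≲⇒≤ᵣ b (x -ᵣ y) (fromℕᵣ u) δ≲u (fromℕᵣ-<--ᵣ x y t 1 u t≤x y<1 u<t)

module _ (t : ℕ) (0<t : 0 ℕ.< t) where

  -- Every modality fails at the start of both words: the singleton has no other position, and the
  -- second position of the pair lies beyond the horizon.
  pair≈singleton : ∀ φ → horizon φ ℕ.< t → pair t 0<t at zero ⊨ φ ⇔ singleton at zero ⊨ φ
  pair≈singleton (atom _) _ = ⇔-id _
  pair≈singleton (φ ∨ᶠ ψ) φ∨ψ<t =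
    pair≈singleton φ (ℕ.m⊔n<o⇒m<o (horizon φ) (horizon ψ) φ∨ψ<t) ⊎-⇔
    pair≈singleton ψ (ℕ.m⊔n<o⇒n<o (horizon φ) (horizon ψ) φ∨ψ<t)
  pair≈singleton (¬ᶠ φ) φ<t = ¬-cong-⇔ (pair≈singleton φ φ<t)
  pair≈singleton (𝖥 ⟨ b , l , u , b′ ⟩ l<u φ) u<t = mk⇔ fwd bwd
    where
    fwd : pair t 0<t at zero ⊨ 𝖥 ⟨ b , l , u , b′ ⟩ l<u φ → singleton at zero ⊨ 𝖥 ⟨ b , l , u , b′ ⟩ l<u φ
    fwd (suc j , _ , (_ , δ≲u) , _) = ⊥-elim
      (out-of-reach b′ (time (pair t 0<t) (suc j)) (time (pair t 0<t) zero)
        (≤ᵣ-refl (fromℕᵣ t)) (fromℕᵣ-mono-< {0} {1} ℕ.≤-refl) u<t δ≲u)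

    bwd : singleton at zero ⊨ 𝖥 ⟨ b , l , u , b′ ⟩ l<u φ → pair t 0<t at zero ⊨ 𝖥 ⟨ b , l , u , b′ ⟩ l<u φ
    bwd (zero , () , _)
  pair≈singleton (𝖯 _ _ _) _ = mk⇔ (λ { (_ , () , _) }) (λ { (_ , () , _) })

eventually : Formula MITL[F∞,P∞] ⊤
eventually = 𝖥 ⟨ closed , 0 ,∞⟩ tt (atom tt)

pair⊨eventually : ∀ t 0<t → pair t 0<t at zero ⊨ eventually
pair⊨eventually t 0<t = suc zero , ℕ.s≤s ℕ.z≤n ,
  dist-nonneg (pair t 0<t) future {zero} {suc zero} (ℕ.s≤s ℕ.z≤n) , refl

singleton⊭eventually : ¬ singleton at zero ⊨ eventually
singleton⊭eventually (zero , () , _)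

eventually-not-bounded : ¬ Definable BoundedMITL[Fb,Pb] (𝓛 eventually)
eventually-not-bounded (φ , L⊆φ , φ⊆L) = singleton⊭eventually (φ⊆L {singleton}
  (to (pair≈singleton t 0<t φ ℕ.≤-refl) (L⊆φ {pair t 0<t} (pair⊨eventually t 0<t))))
  where
  -- The least stamp beyond the horizon of the supposed defining formula.
  t = suc (horizon φ)
  0<t : 0 ℕ.< t
  0<t = ℕ.s≤s ℕ.z≤n

theorem8 : ExcludedMiddle 0ℓ → BoundedMITL[Fb,Pb] ⊊ₑ MITL[F∞,P∞]
theorem8 em =
  Classical.bounded⊆lowerBounded em ,
  ⊤ , (1 , ↔-sym Fin.1↔⊤) , 𝓛 eventually , (eventually , id , id) , eventually-not-bounded
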